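{- Let $n\ge 1$ and let $i,j$ be integers with $0\le i<j\le n$. Then the maximum number $c_{i\rightarrow j}$ of $i$-cells of $\mathbb{C}_n$ that bound a $j$-cell is $$c_{i\rightarrow j}=2^{j-i}\binom{j}{i}.$$
   Context: A cell of $\mathbb{R}^n$ is a product $e=\prod_{k=1}^n I_k$ where, for each $k$, $I_k$ is either a closed interval $[x_k-\frac12,x_k+\frac12]$ or a singleton $\{x_k\pm\frac12\}$, with $x_k\in\mathbb{Z}$. Its dimension $\dim(e)$ is the number of non-degenerate factors; an $i$-cell is a cell of dimension $i$. $\mathbb{C}_n$ is the set of all cells of $\mathbb{R}^n$. We say $e_1$ bounds $e_2$, written $e_1<e_2$, if $e_1\subseteq e_2$ and $\dim(e_1)<\dim(e_2)$. $c_{i\rightarrow j}$ denotes the maximum, over $j$-cells $f$ of $\mathbb{C}_n$, of the number of $i$-cells $e$ with $e<f$. -}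

module Defs where

open import Data.Fin.Base using (Fin)
open import Data.Integer.Base using (ℤ)
open import Data.Nat.Base as ℕ using (ℕ)
open import Data.Product.Base using (Σ; ∃; _×_; _,_; proj₁)
open import Data.Rational.Base using (ℚ; _<_; _+_; _-_; _/_; ½; 1ℚ)
open import Data.Rational.Properties
  using (<-trans; <-asym; <-dense; <-cmp; +-monoʳ-<; +-identityʳ; positive⁻¹; negative⁻¹)
open import Data.Sum.Base using (_⊎_; inj₁; inj₂)
open import Data.Vec.Base using (Vec; count; lookup)
open import Function.Bundles using (Inverse)
open import Level using (Level; 0ℓ; _⊔_)
open import Relation.Binary.Bundles using (Setoid)
open import Relation.Binary.Definitions using (tri<; tri≈; tri>)
import Relation.Binary.Construct.On as On
open import Relation.Binary.PropositionalEquality using (_≡_; refl; subst; setoid)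
open import Relation.Nullary using (¬_; yes; no)
open import Relation.Unary using (Pred; Decidable; _∈_; _⊆_; Satisfiable)
open import Relation.Unary.Relation.Binary.Equality using (≐-setoid)

private variable
  a ℓ : Level
  n : ℕ

record ℝ : Set₁ where
  field
    lower upper     : Pred ℚ 0ℓ
    lower-inhabited : Satisfiable lower
    upper-inhabited : Satisfiable upper
    lower-closed    : ∀ {p q} → p < q → q ∈ lower → p ∈ lower
    upper-closed    : ∀ {p q} → p < q → p ∈ upper → q ∈ upper
    lower-open      : ∀ {p} → p ∈ lower → ∃ λ q → p < q × q ∈ lower
    upper-open      : ∀ {q} → q ∈ upper → ∃ λ p → p < q × p ∈ upper
    disjoint        : ∀ {q} → q ∈ lower → ¬ (q ∈ upper)
    located         : ∀ {p q} → p < q → p ∈ lower ⊎ q ∈ upper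

open ℝ

-- A located Dedekind cut is determined by its lower half, so comparing lower
-- halves is enough.

infix 4 _≤_ _≃_

_≤_ : ℝ → ℝ → Set
x ≤ y = lower x ⊆ lower y

_≃_ : ℝ → ℝ → Set
x ≃ y = x ≤ y × y ≤ x

fromℚ : ℚ → ℝ
fromℚ r = record
  { lower           = _< r
  ; upper           = r <_
  ; lower-inhabited = r - 1ℚ , subst (r - 1ℚ <_) (+-identityʳ r) (+-monoʳ-< r (negative⁻¹ _))
  ; upper-inhabited = r + 1ℚ , subst (_< r + 1ℚ) (+-identityʳ r) (+-monoʳ-< r (positive⁻¹ _))
  ; lower-closed    = <-trans
  ; upper-closed    = λ p<q r<p → <-trans r<p p<q
  ; lower-open      = λ p<r → let q , p<q , q<r = <-dense p<r in q , p<q , q<r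
  ; upper-open      = λ r<q → let p , r<p , p<q = <-dense r<q in p , p<q , r<p
  ; disjoint        = <-asym
  ; located         = fromℚ-located
  }
  where
  fromℚ-located : ∀ {p q} → p < q → p < r ⊎ r < q
  fromℚ-located {p} p<q with <-cmp p r
  ... | tri< p<r _ _    = inj₁ p<r
  ... | tri≈ _ refl _   = inj₂ p<q
  ... | tri> _ _ r<p    = inj₂ (<-trans r<p p<q)

closedInterval : ℝ → ℝ → Pred ℝ 0ℓ
closedInterval x y r = x ≤ r × r ≤ y

singleton : ℝ → Pred ℝ 0ℓ
singleton x r = r ≃ x

-- Expressions for the factors of a cell. They are not unique: point⁺ x and
-- point⁻ (1 + x) denote the same singleton.

data Factor : Set where
  interval      : ℤ → Factor
  point⁻ point⁺ : ℤ → Factor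

factorSet : Factor → Pred ℝ 0ℓ
factorSet (interval x) = closedInterval (fromℚ (x / 1 - ½)) (fromℚ (x / 1 + ½))
factorSet (point⁻ x)   = singleton (fromℚ (x / 1 - ½))
factorSet (point⁺ x)   = singleton (fromℚ (x / 1 + ½))

data NonDegenerate : Pred Factor 0ℓ where
  interval : ∀ x → NonDegenerate (interval x)

nonDegenerate? : Decidable NonDegenerate
nonDegenerate? (interval x) = yes (interval x)
nonDegenerate? (point⁻ x)   = no λ ()
nonDegenerate? (point⁺ x)   = no λ ()

Cell : ℕ → Set
Cell n = Vec Factor n

⟦_⟧ : Cell n → Pred (Vec ℝ n) 0ℓ
⟦ e ⟧ x = ∀ k → lookup x k ∈ factorSet (lookup e k)

-- A product of nonempty sets determines its factors, so dim depends only on ⟦ e ⟧.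

dim : Cell n → ℕ
dim e = count nonDegenerate? e

_Bounds_ : Cell n → Cell n → Set₁
e₁ Bounds e₂ = ⟦ e₁ ⟧ ⊆ ⟦ e₂ ⟧ × dim e₁ ℕ.< dim e₂

-- The i-cells bounding f, identified when they are equal as subsets of ℝⁿ.

BoundingCells : (i : ℕ) → Cell n → Setoid (Level.suc 0ℓ) (Level.suc 0ℓ)
BoundingCells {n} i f = On.setoid (≐-setoid (Vec ℝ n) 0ℓ) ⟦bounding⟧
  where
  ⟦bounding⟧ : (Σ (Cell n) λ e → dim e ≡ i × e Bounds f) → Pred (Vec ℝ n) 0ℓ
  ⟦bounding⟧ (e , _) = ⟦ e ⟧

HasCardinality : Setoid a ℓ → ℕ → Set (a ⊔ ℓ)
HasCardinality S m = Inverse S (setoid (Fin m))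

-- The second component says both that every number concerned is finite and
-- that it is at most m.

IsMaximumCardinality : {A : Set} {a ℓ : Level} → (A → Setoid a ℓ) → ℕ → Set (a ⊔ ℓ)
IsMaximumCardinality {A} S m =
  (∃ λ (x : A) → HasCardinality (S x) m) ×
  (∀ (x : A) → ∃ λ k → HasCardinality (S x) k × k ℕ.≤ m)

-- Is-c n i j m says that c_{i→j} for ℂ_n is equal to m.

Is-c : (n i j : ℕ) → ℕ → Set₁
Is-c n i j = IsMaximumCardinality {A = Σ (Cell n) λ f → dim f ≡ j}
                                  (λ f → BoundingCells i (proj₁ f))

{-# OPTIONS --safe #-}

-- The end of every factor is z - 1/2 for an integer z, so inclusion of cells is a factorwise
-- comparison of integers. A factor inside [x - 1/2 , x + 1/2] is that interval or one of its
-- two ends, and a factor inside a singleton is that singleton. The i-cells in a j-cell are thus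
-- words of length j with i letters "whole" and the others "low" or "high"; their number obeys
-- Pascal's recursion with a weight 2 on the letters that are not "whole".

module Submission where

open import Defs
open import Data.Empty using (⊥-elim)
open import Data.Fin.Base using (Fin)
open import Data.Fin.Properties using (1↔⊤; +↔⊎)
open import Data.Integer.Base as ℤ using (ℤ; 1ℤ) renaming (suc to sucℤ)
import Data.Integer.Properties as ℤ
open import Data.Nat.Base using (ℕ; zero; suc; _∸_; _+_; _*_; _^_; z≤n; s≤s)
  renaming (_≤_ to _≤ℕ_; _<_ to _<ℕ_)
open import Data.Nat.Combinatorics using (_C_; nCk+nC[k+1]≡[n+1]C[k+1]; k>n⇒nCk≡0)
import Data.Nat.Properties as ℕ
open import Data.Product.Base using (Σ; ∃; _×_; _,_; proj₁; proj₂; swap)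
open import Data.Rational.Base as ℚ using (_/_; ½; 1ℚ; toℚᵘ)
import Data.Rational.Properties as ℚ
open import Data.Rational.Unnormalised.Base as ℚᵘ using (mkℚᵘ; *≡*; *≤*)
import Data.Rational.Unnormalised.Properties as ℚᵘ
open import Data.Sum.Base using (_⊎_; inj₁; inj₂)
open import Data.Sum.Function.Propositional using (_⊎-↔_)
open import Data.Vec.Base using ([]; _∷_; lookup; map)
open import Data.Vec.Properties using (lookup-map)
open import Data.Vec.Relation.Binary.Pointwise.Extensional
  using (ext; extensional⇒inductive)
open import Data.Vec.Relation.Binary.Pointwise.Inductive as Pointwise
  using (Pointwise; []; _∷_)
open import Function.Base using (_∘_; id)
open import Function.Bundles using (Inverse; _↔_; mk↔ₛ′)
import Function.Construct.Composition as Composition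
import Function.Construct.Symmetry as Symmetry
open import Function.Properties.Bijection using (Bijection⇒Inverse)
open import Relation.Binary.PropositionalEquality
  using (_≡_; refl; sym; trans; cong; cong₂; subst; module ≡-Reasoning; setoid)
open import Relation.Nullary using (¬_; yes; no)
open import Relation.Unary using (_∈_; _⊆_)

private variable
  n i j : ℕ

-- Order of the integers within the rationals and the reals.

toℚᵘ-/1 : ∀ z → toℚᵘ (z / 1) ℚᵘ.≃ mkℚᵘ z 0
toℚᵘ-/1 z = ℚ.toℚᵘ-fromℚᵘ (mkℚᵘ z 0)

/1-mono-≤ : ∀ {x y} → x ℤ.≤ y → x / 1 ℚ.≤ y / 1
/1-mono-≤ {x} {y} x≤y = ℚ.toℚᵘ-cancel-≤
  (ℚᵘ.≤-respˡ-≃ (ℚᵘ.≃-sym (toℚᵘ-/1 x)) (ℚᵘ.≤-respʳ-≃ (ℚᵘ.≃-sym (toℚᵘ-/1 y))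
    (*≤* (ℤ.*-monoʳ-≤-nonNeg 1ℤ x≤y))))

/1-cancel-≤ : ∀ {x y} → x / 1 ℚ.≤ y / 1 → x ℤ.≤ y
/1-cancel-≤ {x} {y} x≤y
  with *≤* p ← ℚᵘ.≤-respˡ-≃ (toℚᵘ-/1 x) (ℚᵘ.≤-respʳ-≃ (toℚᵘ-/1 y) (ℚ.toℚᵘ-mono-≤ x≤y))
  = ℤ.*-cancelʳ-≤-pos x y 1ℤ p

/1-suc : ∀ z → sucℤ z / 1 ≡ 1ℚ ℚ.+ z / 1
/1-suc z = ℚ.toℚᵘ-injective (begin
  toℚᵘ (sucℤ z / 1)              ≈⟨ toℚᵘ-/1 (sucℤ z) ⟩
  mkℚᵘ (sucℤ z) 0                ≈⟨ *≡* (cong (ℤ._* 1ℤ) (cong sucℤ (sym (ℤ.*-identityʳ z)))) ⟩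
  mkℚᵘ 1ℤ 0 ℚᵘ.+ mkℚᵘ z 0        ≈⟨ ℚᵘ.+-congʳ (mkℚᵘ 1ℤ 0) (toℚᵘ-/1 z) ⟨
  toℚᵘ 1ℚ ℚᵘ.+ toℚᵘ (z / 1)      ≈⟨ ℚ.toℚᵘ-homo-+ 1ℚ (z / 1) ⟨
  toℚᵘ (1ℚ ℚ.+ z / 1)            ∎)
  where open ℚᵘ.≃-Reasoning

-- This turns an upper end `x + ½` into the lower end belonging to `sucℤ x`, so that every end of a
-- factor is a `wall`. After reassociation `1ℚ ℚ.- ½` computes to `½`.
/1-suc-½ : ∀ z → sucℤ z / 1 ℚ.- ½ ≡ z / 1 ℚ.+ ½
/1-suc-½ z = begin
  sucℤ z / 1 ℚ.- ½          ≡⟨ cong (ℚ._- ½) (trans (/1-suc z) (ℚ.+-comm 1ℚ (z / 1))) ⟩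
  z / 1 ℚ.+ 1ℚ ℚ.- ½        ≡⟨ ℚ.+-assoc (z / 1) 1ℚ (ℚ.- ½) ⟩
  z / 1 ℚ.+ ½               ∎
  where open ≡-Reasoning

fromℚ-mono-≤ : ∀ {p q} → p ℚ.≤ q → fromℚ p ≤ fromℚ q
fromℚ-mono-≤ p≤q r<p = ℚ.<-≤-trans r<p p≤q

fromℚ-cancel-≤ : ∀ {p q} → fromℚ p ≤ fromℚ q → p ℚ.≤ q
-- If `q < p`, then `q` lies in the lower half of `fromℚ p`, hence in that of `fromℚ q`, which gives
-- `q < q`.
fromℚ-cancel-≤ p≤q = ℚ.≮⇒≥ (λ q<p → ℚ.<-irrefl refl (p≤q q<p))

wall : ℤ → ℝ
wall z = fromℚ (z / 1 ℚ.- ½)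

wall-mono-≤ : ∀ {x y} → x ℤ.≤ y → wall x ≤ wall y
wall-mono-≤ x≤y = fromℚ-mono-≤ (ℚ.+-monoˡ-≤ (ℚ.- ½) (/1-mono-≤ x≤y))

wall-cancel-≤ : ∀ {x y} → wall x ≤ wall y → x ℤ.≤ y
wall-cancel-≤ {x} {y} p = /1-cancel-≤
  (subst (λ r → r ℚ.≤ y / 1) (shift x) (subst (λ r → x / 1 ℚ.- ½ ℚ.+ ½ ℚ.≤ r) (shift y)
    (ℚ.+-monoˡ-≤ ½ (fromℚ-cancel-≤ p))))
  where
  shift : ∀ z → z / 1 ℚ.- ½ ℚ.+ ½ ≡ z / 1
  shift z = trans (ℚ.+-assoc (z / 1) (ℚ.- ½) ½) (ℚ.+-identityʳ (z / 1))

-- Inclusion of cells as a comparison of integers.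

lo hi : Factor → ℤ
lo (interval x) = x
lo (point⁻ x)   = x
lo (point⁺ x)   = sucℤ x
hi (interval x) = sucℤ x
hi (point⁻ x)   = x
hi (point⁺ x)   = sucℤ x

lo≤hi : ∀ F → lo F ℤ.≤ hi F
lo≤hi (interval x) = ℤ.i≤suc[i] x
lo≤hi (point⁻ x)   = ℤ.≤-refl
lo≤hi (point⁺ x)   = ℤ.≤-refl

-- A point has equal `lo` and `hi`, and `≃` is a pair of opposite inequalities, so a singleton is
-- also the set between two walls; only the order of the pair differs.
factorSet⁺ : ∀ F {r} → wall (lo F) ≤ r → r ≤ wall (hi F) → r ∈ factorSet F
factorSet⁺ (interval x) l u rewrite /1-suc-½ x = l , u
factorSet⁺ (point⁻ x)   l u = u , l
factorSet⁺ (point⁺ x)   l u rewrite /1-suc-½ x = u , l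

factorSet⁻ : ∀ F {r} → r ∈ factorSet F → wall (lo F) ≤ r × r ≤ wall (hi F)
factorSet⁻ (interval x) (l , u) rewrite /1-suc-½ x = l , u
factorSet⁻ (point⁻ x)   (u , l) = l , u
factorSet⁻ (point⁺ x)   (u , l) rewrite /1-suc-½ x = l , u

infix 4 _⊑_ _⊑*_

-- Not antisymmetric: `point⁺ x` and `point⁻ (sucℤ x)` are below each other. Equality of cells as
-- sets thus becomes comparison in both directions instead of `≡`.
_⊑_ : Factor → Factor → Set
F ⊑ G = lo G ℤ.≤ lo F × hi F ℤ.≤ hi G

_⊑*_ : Cell n → Cell n → Set
_⊑*_ = Pointwise _⊑_

⊑-refl : ∀ {F} → F ⊑ F
⊑-refl = ℤ.≤-refl , ℤ.≤-refl

⊑*⇒⊆ : {e f : Cell n} → e ⊑* f → ⟦ e ⟧ ⊆ ⟦ f ⟧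
⊑*⇒⊆ {e = e} {f} e⊑f {x} x∈e k =
  let l , u = factorSet⁻ (lookup e k) {lookup x k} (x∈e k)
      l′ , u′ = Pointwise.lookup e⊑f k
  in factorSet⁺ (lookup f k) {lookup x k}
       (λ p → l (wall-mono-≤ l′ p)) (λ p → wall-mono-≤ u′ (u p))

corner-∈ : (s : Factor → ℤ) → (∀ F → lo F ℤ.≤ s F × s F ℤ.≤ hi F) →
           (e : Cell n) → map (wall ∘ s) e ∈ ⟦ e ⟧
corner-∈ s s∈ e k rewrite lookup-map k (wall ∘ s) e =
  factorSet⁺ (lookup e k) (wall-mono-≤ (proj₁ (s∈ (lookup e k))))
                          (wall-mono-≤ (proj₂ (s∈ (lookup e k))))

-- Two test points suffice: the corner of `e` made of all lower ends bounds each `lo`, the one made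
-- of all upper ends bounds each `hi`.
⊆⇒⊑* : {e f : Cell n} → ⟦ e ⟧ ⊆ ⟦ f ⟧ → e ⊑* f
⊆⇒⊑* {e = e} {f} e⊆f = extensional⇒inductive (ext (λ k →
    wall-cancel-≤ (proj₁ (ends lo (λ F → ℤ.≤-refl , lo≤hi F) k))
  , wall-cancel-≤ (proj₂ (ends hi (λ F → lo≤hi F , ℤ.≤-refl) k))))
  where
  ends : (s : Factor → ℤ) → (∀ F → lo F ℤ.≤ s F × s F ℤ.≤ hi F) → ∀ k →
         wall (lo (lookup f k)) ≤ wall (s (lookup e k)) ×
         wall (s (lookup e k)) ≤ wall (hi (lookup f k))
  ends s s∈ k = factorSet⁻ (lookup f k)
    (subst (_∈ factorSet (lookup f k)) (lookup-map k (wall ∘ s) e) (e⊆f {map (wall ∘ s) e} (corner-∈ s s∈ e) k))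

-- Faces of a cell as words.

data Face : ℕ → ℕ → Set where
  []       : Face 0 0
  whole    : Face i j → Face (suc i) (suc j)
  low high : Face i j → Face i (suc j)

-- Only an interval of `f` uses up a letter and points are copied, so the word has length `dim f`.
toCell : (f : Cell n) → Face i (dim f) → Cell n
toCell []               []        = []
toCell (interval x ∷ f) (whole c) = interval x ∷ toCell f c
toCell (interval x ∷ f) (low c)   = point⁻ x ∷ toCell f c
toCell (interval x ∷ f) (high c)  = point⁺ x ∷ toCell f c
toCell (point⁻ x ∷ f)   c         = point⁻ x ∷ toCell f c
toCell (point⁺ x ∷ f)   c         = point⁺ x ∷ toCell f c

dim-toCell : (f : Cell n) (c : Face i (dim f)) → dim (toCell f c) ≡ i
dim-toCell []               []        = refl
dim-toCell (interval x ∷ f) (whole c) = cong suc (dim-toCell f c)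
dim-toCell (interval x ∷ f) (low c)   = dim-toCell f c
dim-toCell (interval x ∷ f) (high c)  = dim-toCell f c
dim-toCell (point⁻ x ∷ f)   c         = dim-toCell f c
dim-toCell (point⁺ x ∷ f)   c         = dim-toCell f c

toCell-⊑* : (f : Cell n) (c : Face i (dim f)) → toCell f c ⊑* f
toCell-⊑* []               []        = []
toCell-⊑* (interval x ∷ f) (whole c) = ⊑-refl {interval x} ∷ toCell-⊑* f c
toCell-⊑* (interval x ∷ f) (low c)   = (ℤ.≤-refl , ℤ.i≤suc[i] x) ∷ toCell-⊑* f c
toCell-⊑* (interval x ∷ f) (high c)  = (ℤ.i≤suc[i] x , ℤ.≤-refl) ∷ toCell-⊑* f c
toCell-⊑* (point⁻ x ∷ f)   c         = ⊑-refl {point⁻ x} ∷ toCell-⊑* f c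
toCell-⊑* (point⁺ x ∷ f)   c         = ⊑-refl {point⁺ x} ∷ toCell-⊑* f c

suc[i]≰i : ∀ x → ¬ sucℤ x ℤ.≤ x
suc[i]≰i x p = ℤ.<-irrefl refl (ℤ.suc[i]≤j⇒i<j p)

-- The two inclusions say that the cells are equal as sets. Different letters at one place would
-- force `sucℤ x ℤ.≤ x`.
toCell-injective : (f : Cell n) (c c′ : Face i (dim f)) →
                   toCell f c ⊑* toCell f c′ → toCell f c′ ⊑* toCell f c → c ≡ c′
toCell-injective [] [] [] _ _ = refl
toCell-injective (interval x ∷ f) (whole c) (whole c′) (_ ∷ p) (_ ∷ q) =
  cong whole (toCell-injective f c c′ p q)
toCell-injective (interval x ∷ f) (low c)   (low c′)   (_ ∷ p) (_ ∷ q) =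
  cong low (toCell-injective f c c′ p q)
toCell-injective (interval x ∷ f) (high c)  (high c′)  (_ ∷ p) (_ ∷ q) =
  cong high (toCell-injective f c c′ p q)
toCell-injective (interval x ∷ f) (whole _) (low _)   ((_ , u) ∷ _) _ = ⊥-elim (suc[i]≰i x u)
toCell-injective (interval x ∷ f) (whole _) (high _)  ((l , _) ∷ _) _ = ⊥-elim (suc[i]≰i x l)
toCell-injective (interval x ∷ f) (low _)   (whole _) _ ((_ , u) ∷ _) = ⊥-elim (suc[i]≰i x u)
toCell-injective (interval x ∷ f) (low _)   (high _)  ((l , _) ∷ _) _ = ⊥-elim (suc[i]≰i x l)
toCell-injective (interval x ∷ f) (high _)  (whole _) _ ((l , _) ∷ _) = ⊥-elim (suc[i]≰i x l)
toCell-injective (interval x ∷ f) (high _)  (low _)   ((_ , u) ∷ _) _ = ⊥-elim (suc[i]≰i x u)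
toCell-injective (point⁻ x ∷ f) c c′ (_ ∷ p) (_ ∷ q) = toCell-injective f c c′ p q
toCell-injective (point⁺ x ∷ f) c c′ (_ ∷ p) (_ ∷ q) = toCell-injective f c c′ p q

-- No integer lies strictly between `x` and `sucℤ x`. Each alternative is already the pair of bounds
-- that `⊑` asks of a point at `z` and that end.
end-of-interval : ∀ {x z} → x ℤ.≤ z → z ℤ.≤ sucℤ x →
                  (x ℤ.≤ z × z ℤ.≤ x) ⊎ (sucℤ x ℤ.≤ z × z ℤ.≤ sucℤ x)
end-of-interval {x} {z} l u with z ℤ.≤? x
... | yes z≤x = inj₁ (l , z≤x)
... | no  z≰x = inj₂ (ℤ.i<j⇒suc[i]≤j (ℤ.≰⇒> z≰x) , u)

-- Each factor of `e` inside an interval of `f` determines a letter. The match is only up to mutual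
-- inclusion, since `e` may write a point in the other form.
toCell-surjective : (e f : Cell n) → e ⊑* f →
                    ∃ λ (c : Face (dim e) (dim f)) → toCell f c ⊑* e × e ⊑* toCell f c
toCell-surjective [] [] [] = [] , [] , []
toCell-surjective (F ∷ e) (G ∷ f) (F⊑G ∷ e⊑f) with toCell-surjective e f e⊑f
toCell-surjective (interval y ∷ e) (interval x ∷ f) ((l , u) ∷ _) | c , p , q =
  whole c , (y≤x , ℤ.suc-mono l) ∷ p , (l , u) ∷ q
  -- From `x < y` would follow `sucℤ y ≤ sucℤ x ≤ y`.
  where y≤x = ℤ.≮⇒≥ λ x<y → suc[i]≰i y (ℤ.≤-trans u (ℤ.i<j⇒suc[i]≤j x<y))
toCell-surjective (point⁻ y ∷ e) (interval x ∷ f) ((l , u) ∷ _) | c , p , q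
  with end-of-interval l u
... | inj₁ r = low c  , swap r ∷ p , r ∷ q
... | inj₂ r = high c , swap r ∷ p , r ∷ q
toCell-surjective (point⁺ y ∷ e) (interval x ∷ f) ((l , u) ∷ _) | c , p , q
  with end-of-interval l u
... | inj₁ r = low c  , swap r ∷ p , r ∷ q
... | inj₂ r = high c , swap r ∷ p , r ∷ q
-- An interval cannot fit in a point: its `hi` would be at most its `lo`.
toCell-surjective (interval y ∷ _) (point⁻ x ∷ _) ((l , u) ∷ _) | _ =
  ⊥-elim (suc[i]≰i y (ℤ.≤-trans u l))
toCell-surjective (interval y ∷ _) (point⁺ x ∷ _) ((l , u) ∷ _) | _ =
  ⊥-elim (suc[i]≰i y (ℤ.≤-trans u l))
-- Between two points the bounds on `lo` and `hi` are opposite inequalities, so swapping them gives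
-- the reverse inclusion.
toCell-surjective (point⁻ _ ∷ _) (point⁻ _ ∷ _) (r ∷ _) | c , p , q = c , swap r ∷ p , r ∷ q
toCell-surjective (point⁻ _ ∷ _) (point⁺ _ ∷ _) (r ∷ _) | c , p , q = c , swap r ∷ p , r ∷ q
toCell-surjective (point⁺ _ ∷ _) (point⁻ _ ∷ _) (r ∷ _) | c , p , q = c , swap r ∷ p , r ∷ q
toCell-surjective (point⁺ _ ∷ _) (point⁺ _ ∷ _) (r ∷ _) | c , p , q = c , swap r ∷ p , r ∷ q

BoundingCells-inverse : (f : Cell n) → i <ℕ dim f →
                        Inverse (BoundingCells i f) (setoid (Face i (dim f)))
BoundingCells-inverse {i = i} f i<dim =
  -- The bijection is built from words to cells, the direction given by recursion, and then
  -- reversed.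
  Symmetry.inverse (Bijection⇒Inverse (record
    { to        = λ c → toCell f c , dim-toCell f c
                      , (λ {x} → ⊑*⇒⊆ (toCell-⊑* f c) {x})
                      , subst (_<ℕ dim f) (sym (dim-toCell f c)) i<dim
    ; cong      = λ { refl → (λ {_} → id) , (λ {_} → id) }
    ; bijective =
        (λ {c} {c′} (p , q) →
           toCell-injective f c c′ (⊆⇒⊑* λ {x} → p {x}) (⊆⇒⊑* λ {x} → q {x}))
      , λ { (e , refl , e⊆f , _) →
            let c , p , q = toCell-surjective e f (⊆⇒⊑* λ {x} → e⊆f {x})
            in c , λ { refl → (λ {x} → ⊑*⇒⊆ p {x}) , (λ {x} → ⊑*⇒⊆ q {x}) } }
    }))

-- Counting words.

faceCount : ℕ → ℕ → ℕ
faceCount zero    zero    = 1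
faceCount (suc i) zero    = 0
faceCount zero    (suc j) = faceCount zero j + faceCount zero j
faceCount (suc i) (suc j) = faceCount i j + (faceCount (suc i) j + faceCount (suc i) j)

Face-00↔ : Fin 1 ↔ Face 0 0
Face-00↔ = Composition.inverse 1↔⊤
  (mk↔ₛ′ (λ _ → []) _ (λ { [] → refl }) (λ _ → refl))

Face-s0↔ : Fin 0 ↔ Face (suc i) 0
Face-s0↔ = mk↔ₛ′ (λ ()) (λ ()) (λ ()) (λ ())

Face-0s↔ : (Face 0 j ⊎ Face 0 j) ↔ Face 0 (suc j)
Face-0s↔ = mk↔ₛ′
  (λ { (inj₁ c) → low c ; (inj₂ c) → high c })
  (λ { (low c) → inj₁ c ; (high c) → inj₂ c })
  (λ { (low c) → refl ; (high c) → refl })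
  (λ { (inj₁ c) → refl ; (inj₂ c) → refl })

Face-ss↔ : (Face i j ⊎ (Face (suc i) j ⊎ Face (suc i) j)) ↔ Face (suc i) (suc j)
Face-ss↔ = mk↔ₛ′
  (λ { (inj₁ c) → whole c ; (inj₂ (inj₁ c)) → low c ; (inj₂ (inj₂ c)) → high c })
  (λ { (whole c) → inj₁ c ; (low c) → inj₂ (inj₁ c) ; (high c) → inj₂ (inj₂ c) })
  (λ { (whole c) → refl ; (low c) → refl ; (high c) → refl })
  (λ { (inj₁ c) → refl ; (inj₂ (inj₁ c)) → refl ; (inj₂ (inj₂ c)) → refl })

Fin↔Face : ∀ i j → Fin (faceCount i j) ↔ Face i j
Fin↔Face zero    zero    = Face-00↔
Fin↔Face (suc i) zero    = Face-s0↔
Fin↔Face zero    (suc j) =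
  Composition.inverse +↔⊎ (Composition.inverse (Fin↔Face zero j ⊎-↔ Fin↔Face zero j) Face-0s↔)
Fin↔Face (suc i) (suc j) =
  Composition.inverse +↔⊎
    (Composition.inverse
      (Fin↔Face i j ⊎-↔
        Composition.inverse +↔⊎ (Fin↔Face (suc i) j ⊎-↔ Fin↔Face (suc i) j))
      Face-ss↔)

-- For j < i both sides vanish: the truncated j ∸ i is harmless.
2^[1+j∸i]*C : ∀ i j → 2 ^ (suc j ∸ i) * (j C i) ≡ 2 * (2 ^ (j ∸ i) * (j C i))
2^[1+j∸i]*C i j with i ℕ.≤? j
... | yes i≤j rewrite ℕ.+-∸-assoc 1 i≤j = ℕ.*-assoc 2 (2 ^ (j ∸ i)) (j C i)
... | no  i≰j rewrite k>n⇒nCk≡0 (ℕ.≰⇒> i≰j)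
                    | ℕ.*-zeroʳ (2 ^ (suc j ∸ i)) | ℕ.*-zeroʳ (2 ^ (j ∸ i)) = refl

double : ∀ m → m + m ≡ 2 * m
double m = cong (m +_) (sym (ℕ.+-identityʳ m))

-- The induction ranges over all `i` and `j`, because the recursion from `i = j` reaches words with
-- more `whole` letters than their length, where both sides are zero.
faceCount≡ : ∀ i j → faceCount i j ≡ 2 ^ (j ∸ i) * (j C i)
faceCount≡ zero    zero    = refl
faceCount≡ (suc i) zero    = refl
faceCount≡ zero    (suc j) = begin
  faceCount 0 j + faceCount 0 j  ≡⟨ double (faceCount 0 j) ⟩
  2 * faceCount 0 j              ≡⟨ cong (2 *_) (faceCount≡ 0 j) ⟩
  2 * (2 ^ j * (j C 0))          ≡⟨ ℕ.*-assoc 2 (2 ^ j) (j C 0) ⟨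
  -- `j C 0` and `suc j C 0` agree by computation.
  2 ^ suc j * (j C 0)            ∎
  where open ≡-Reasoning
faceCount≡ (suc i) (suc j) = begin
  faceCount i j + (faceCount (suc i) j + faceCount (suc i) j)
    ≡⟨ cong₂ _+_ (faceCount≡ i j) (double (faceCount (suc i) j)) ⟩
  2 ^ (j ∸ i) * (j C i) + 2 * faceCount (suc i) j
    ≡⟨ cong (λ m → 2 ^ (j ∸ i) * (j C i) + 2 * m) (faceCount≡ (suc i) j) ⟩
  2 ^ (j ∸ i) * (j C i) + 2 * (2 ^ (j ∸ suc i) * (j C suc i))
    -- Since `suc j ∸ suc i` reduces to `j ∸ i`, the factor 2 gives both terms the same power of
    -- two, ready for Pascal's rule.
    ≡⟨ cong (2 ^ (j ∸ i) * (j C i) +_) (2^[1+j∸i]*C (suc i) j) ⟨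
  2 ^ (j ∸ i) * (j C i) + 2 ^ (j ∸ i) * (j C suc i)
    ≡⟨ ℕ.*-distribˡ-+ (2 ^ (j ∸ i)) (j C i) (j C suc i) ⟨
  2 ^ (j ∸ i) * (j C i + j C suc i)
    ≡⟨ cong (2 ^ (j ∸ i) *_) (nCk+nC[k+1]≡[n+1]C[k+1] j i) ⟩
  2 ^ (j ∸ i) * (suc j C suc i)
    ∎
  where open ≡-Reasoning

-- The cardinality and its maximum.

BoundingCells-cardinality : (f : Cell n) → i <ℕ dim f →
  HasCardinality (BoundingCells i f) (2 ^ (dim f ∸ i) * (dim f C i))
BoundingCells-cardinality {i = i} f i<dim =
  subst (HasCardinality (BoundingCells i f)) (faceCount≡ i (dim f))
    (Composition.inverse (BoundingCells-inverse f i<dim)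
                         (Symmetry.inverse (Fin↔Face i (dim f))))

-- A cell to attain the maximum: `j` intervals followed by points, all at the arbitrary position
-- `1ℤ`.
cellOfDim : j ≤ℕ n → Σ (Cell n) λ f → dim f ≡ j
cellOfDim {n = zero}  z≤n       = [] , refl
cellOfDim {n = suc n} z≤n       = let f , eq = cellOfDim z≤n in point⁻ 1ℤ ∷ f , eq
cellOfDim             (s≤s j≤n) = let f , eq = cellOfDim j≤n in interval 1ℤ ∷ f , cong suc eq

proposition9 : (n i j : ℕ) → 1 ≤ℕ n → i <ℕ j → j ≤ℕ n →
    Is-c n i j (2 ^ (j ∸ i) * (j C i))
proposition9 n i j _ i<j j≤n =
    -- The count depends on a cell only through its dimension, so every `j`-cell attains the maximum
    -- and the bound holds with equality.
    (cellOfDim j≤n , cardinality (cellOfDim j≤n))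
  , λ f → _ , cardinality f , ℕ.≤-refl
  where
  cardinality : (f : Σ (Cell n) λ f → dim f ≡ j) →
    HasCardinality (BoundingCells i (proj₁ f)) (2 ^ (j ∸ i) * (j C i))
  cardinality (f , refl) = BoundingCells-cardinality f i<j
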